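{- Let $X$, $Y$ be graphs, let $\varphi\in\mathrm{O}(X,Y)$ be $\mathfrak{G}$-consistent for a subgroup $\mathfrak{G}\leq\mathrm{Aut}(X)$, and let $y\in V_Y$. (i) For each $C\in\mathcal{C}(X)_y$, $\mathcal{C}(X)_y=\{f(C):f\in\mathfrak{G}\}$. In particular, the components of $X$ belonging to $\mathcal{C}(X)_y$ are isomorphic to each other through a graph automorphism of $X$. (ii) $\mathrm{O}(X,Y)\subseteq\mathrm{CE}(X,Y)$. (iii) If $\varphi\in\mathrm{O}(X,Y)\cap\mathrm{Com}(X,Y)$, then $c(X)_y=\frac{|\varphi^{ -1}(\varphi(V_C))|}{|V_C|}$ for all $C\in\mathcal{C}(X)_y$.
   Context: All graphs are finite, undirected, simple and reflexive: a graph $X=(V_X,E_X)$ has a finite nonempty vertex set $V_X$, and $E_X$ consists of all loops $\{x\}$ ($x\in V_X$) together with a (possibly empty) set of $2$-element subsets of $V_X$. A homomorphism $\varphi:X\to Y$ is a map $\varphi:V_X\to V_Y$ such that $\{x_1,x_2\}\in E_X$ implies $\{\varphi(x_1),\varphi(x_2)\}\in E_Y$ (a proper edge may be mapped to a loop). For a subgraph $\hat X$ of $X$ its image is $\varphi(\hat X)=(\varphi(V_{\hat X}),\varphi(E_{\hat X}))$. $\mathrm{Com}(X,Y)$ is the set of complete homomorphisms, i.e. those with $\varphi(V_X)=V_Y$ and $\varphi(E_X)=E_Y$. $\mathrm{O}(X,Y)$ is the set of orbit homomorphisms: those for which the nonempty fibres of $\varphi$ are exactly the orbits on $V_X$ of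 some subgroup $\mathfrak{G}\leq\mathrm{Aut}(X)$; for such a $\mathfrak{G}$ one says $\varphi$ is $\mathfrak{G}$-consistent. $\mathcal{C}(X)$ is the set of components (maximal connected subgraphs) of $X$. For $y\in V_Y$ and $C\in\mathcal{C}(X)$, $k_C(y)=|V_C\cap\varphi^{ -1}(y)|$; $\mathcal{C}(X)_y=\{C\in\mathcal{C}(X):k_C(y)>0\}$ and $c(X)_y=|\mathcal{C}(X)_y|$. $\mathrm{CE}(X,Y)$ is the set of component equitable homomorphisms $\varphi: X\to Y$: those such that for every $y\in V_Y$ and all $C,\hat C\in\mathcal{C}(X)_y$ one has $k_C(y)=k_{\hat C}(y)$. -}

module Defs where

open import Algebra.Bundles using (Group)
open import Data.Fin.Base using (Fin)
open import Data.Fin.Properties using (_≟_; any?)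
open import Data.Fin.Subset as Subset using (Subset; Nonempty; ∣_∣) renaming (_∈_ to _∈ˢ_; _∩_ to _∩ˢ_)
open import Data.Fin.Subset.Properties using (_∈?_; ∈⊤; x∈p⇒∣p-x∣<∣p∣)
open import Data.Nat.Base as ℕ using (ℕ; NonZero; _<_)
open import Data.Nat.Properties using (≤-<-trans)
open import Data.Product.Base using (Σ; ∃; ∃-syntax; _×_; _,_; proj₁; proj₂)
open import Data.Vec.Base using (tabulate)
open import Data.Vec.Properties using (lookup∘tabulate; []=⇒lookup; lookup⇒[]=)
open import Function.Base using (_∘_; id; _on_)
open import Function.Bundles using (Inverse; _⇔_)
open import Level using (0ℓ; suc; _⊔_)
open import Relation.Binary.Bundles using (Setoid)
open import Relation.Binary.Construct.Closure.ReflexiveTransitive using (Star)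
open import Relation.Binary.Core using (Rel; _⇒_)
open import Relation.Binary.Definitions using (Decidable; Reflexive; Symmetric)
open import Relation.Binary.PropositionalEquality
  using (_≡_; refl; sym; trans; cong; setoid)
open import Relation.Nullary.Decidable using (does; yes; no; _×-dec_; dec-true)
open import Relation.Unary as U using (Pred; _≐_)

-- The edge {x , y} (a loop when x ≡ y) is encoded as x ~ y.  Decidability of
-- _~_ says that E_X is a subset of the finite set of possible edges.
record Graph : Set₁ where
  infix 4 _~_ _~?_
  field
    order    : ℕ
    nonempty : NonZero order
  V : Set
  V = Fin order
  field
    _~_    : Rel V 0ℓ
    _~?_   : Decidable _~_
    ~-refl : Reflexive _~_
    ~-sym  : Symmetric _~_

open Graph using (V; order)

record Hom (X Y : Graph) : Set where
  private
    module X = Graph X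
    module Y = Graph Y
  field
    to       : V X → V Y
    preserve : ∀ {x₁ x₂} → x₁ X.~ x₂ → to x₁ Y.~ to x₂

open Hom using (to; preserve)

idʰ : ∀ {X} → Hom X X
idʰ = record { to = id ; preserve = id }

infixr 9 _∘ʰ_
_∘ʰ_ : ∀ {X Y Z} → Hom Y Z → Hom X Y → Hom X Z
ψ ∘ʰ φ = record { to = to ψ ∘ to φ ; preserve = preserve ψ ∘ preserve φ }

record Automorphism (X : Graph) : Set where
  field
    hom      : Hom X X
    inv      : Hom X X
    inverseˡ : ∀ x → to hom (to inv x) ≡ x
    inverseʳ : ∀ x → to inv (to hom x) ≡ x

open Automorphism using (hom; inv; inverseˡ; inverseʳ)

-- The group law is composition; automorphisms are compared pointwise.
Aut : Graph → Group 0ℓ 0ℓ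
Aut X = record
  { Carrier = Automorphism X
  ; _≈_     = λ f g → ∀ x → to (hom f) x ≡ to (hom g) x
  ; _∙_     = λ f g → record
      { hom      = hom f ∘ʰ hom g
      ; inv      = inv g ∘ʰ inv f
      ; inverseˡ = λ x → trans (cong (to (hom f)) (inverseˡ g _)) (inverseˡ f x)
      ; inverseʳ = λ x → trans (cong (to (inv g)) (inverseʳ f _)) (inverseʳ g x)
      }
  ; ε       = record
      { hom = idʰ ; inv = idʰ ; inverseˡ = λ _ → refl ; inverseʳ = λ _ → refl }
  ; _⁻¹     = λ f → record
      { hom = inv f ; inv = hom f ; inverseˡ = inverseʳ f ; inverseʳ = inverseˡ f }
  ; isGroup = record
      { isMonoid = record
          { isSemigroup = record
              { isMagma = record
                  { isEquivalence = record
                      { refl  = λ _ → refl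
                      ; sym   = λ p x → sym (p x)
                      ; trans = λ p q x → trans (p x) (q x)
                      }
                  ; ∙-cong = λ {f} p q x → trans (cong (to (hom f)) (q x)) (p _)
                  }
              ; assoc = λ _ _ _ _ → refl
              }
          ; identity = (λ _ _ → refl) , (λ _ _ → refl)
          }
      ; inverse = inverseʳ , inverseˡ
      ; ⁻¹-cong = λ {f} {g} p x →
          trans (sym (inverseʳ g _))
                (cong (to (inv g)) (trans (sym (p _)) (inverseˡ f x)))
      }
  }

record Subgroup {c ℓ} (G : Group c ℓ) : Set (suc 0ℓ ⊔ c ⊔ ℓ) where
  open Group G
  field
    Member    : Pred Carrier 0ℓ
    resp-≈    : ∀ {f g} → f ≈ g → Member f → Member g
    ε-closed  : Member ε
    ∙-closed  : ∀ {f g} → Member f → Member g → Member (f ∙ g)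
    ⁻¹-closed : ∀ {f} → Member f → Member (f ⁻¹)

open Subgroup using (Member)

comprehension : ∀ {n} {P : Pred (Fin n) 0ℓ} → U.Decidable P → Subset n
comprehension P? = tabulate (does ∘ P?)

∈-comprehension : ∀ {n} {P : Pred (Fin n) 0ℓ} (P? : U.Decidable P) {x} →
                  P x → x ∈ˢ comprehension P?
∈-comprehension P? {x} px =
  lookup⇒[]= x _ (trans (lookup∘tabulate (does ∘ P?) x) (dec-true (P? x) px))

comprehension-∈ : ∀ {n} {P : Pred (Fin n) 0ℓ} (P? : U.Decidable P) {x} →
                  x ∈ˢ comprehension P? → P x
comprehension-∈ P? {x} x∈
  with P? x | trans (sym (lookup∘tabulate (does ∘ P?) x)) ([]=⇒lookup x∈)
... | yes px | _  = px
... | no  _  | ()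

-- Subgraphs are themselves graphs in the above sense, hence nonempty and
-- containing the loop at each of their vertices.
record Subgraph (X : Graph) : Set₁ where
  open Graph X using (_~_)
  field
    vertices : Subset (order X)
    nonempty : Nonempty vertices
    Edge     : Rel (V X) 0ℓ
    Edge?    : Decidable Edge
    loops    : ∀ {x} → x ∈ˢ vertices → Edge x x
    Edge-sym : Symmetric Edge
    endpoint : ∀ {x y} → Edge x y → x ∈ˢ vertices
    Edge⇒~   : Edge ⇒ _~_

open Subgraph using (vertices; Edge)

infix 4 _⊑_ _≋_
_⊑_ : ∀ {X} → Rel (Subgraph X) 0ℓ
C ⊑ D = (vertices C Subset.⊆ vertices D) × (Edge C ⇒ Edge D)

_≋_ : ∀ {X} → Rel (Subgraph X) 0ℓ
C ≋ D = C ⊑ D × D ⊑ C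

whole : ∀ X → Subgraph X
whole X = record
  { vertices = Subset.⊤
  ; nonempty = vertex (order X) (Graph.nonempty X) , ∈⊤
  ; Edge     = Graph._~_ X
  ; Edge?    = Graph._~?_ X
  ; loops    = λ _ → Graph.~-refl X
  ; Edge-sym = Graph.~-sym X
  ; endpoint = λ _ → ∈⊤
  ; Edge⇒~   = id
  }
  where
  vertex : ∀ n → NonZero n → Fin n
  vertex (ℕ.suc _) _ = Fin.zero

hit? : ∀ {X Y} (φ : Hom X Y) (S : Subset (order X)) →
       U.Decidable (λ y → ∃[ x ] x ∈ˢ S × to φ x ≡ y)
hit? φ S y = any? (λ x → (x ∈? S) ×-dec (to φ x ≟ y))

imageⱽ : ∀ {X Y} → Hom X Y → Subset (order X) → Subset (order Y)
imageⱽ φ S = comprehension (hit? φ S)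

preimageⱽ : ∀ {X Y} → Hom X Y → Subset (order Y) → Subset (order X)
preimageⱽ φ T = comprehension (λ x → to φ x ∈? T)

image : ∀ {X Y} → Hom X Y → Subgraph X → Subgraph Y
image {X} {Y} φ C = record
  { vertices = imageⱽ φ (vertices C)
  ; nonempty = to φ (proj₁ C.nonempty) , ∈⁺ (proj₂ C.nonempty)
  ; Edge     = λ y₁ y₂ → ∃[ x₁ ] ∃[ x₂ ] Edge C x₁ x₂ × to φ x₁ ≡ y₁ × to φ x₂ ≡ y₂
  ; Edge?    = λ y₁ y₂ → any? λ x₁ → any? λ x₂ →
                 C.Edge? x₁ x₂ ×-dec (to φ x₁ ≟ y₁) ×-dec (to φ x₂ ≟ y₂)
  ; loops    = λ y∈ → let (x , x∈ , p) = comprehension-∈ (hit? φ (vertices C)) y∈ in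
                 x , x , C.loops x∈ , p , p
  ; Edge-sym = λ (x₁ , x₂ , e , p , q) → x₂ , x₁ , C.Edge-sym e , q , p
  ; endpoint = λ { (x₁ , x₂ , e , refl , _) → ∈⁺ (C.endpoint e) }
  ; Edge⇒~   = λ { (x₁ , x₂ , e , refl , refl) → preserve φ (C.Edge⇒~ e) }
  }
  where
  module C = Subgraph C
  ∈⁺ : ∀ {x} → x ∈ˢ vertices C → to φ x ∈ˢ imageⱽ φ (vertices C)
  ∈⁺ x∈ = ∈-comprehension (hit? φ (vertices C)) (_ , x∈ , refl)

Connected : ∀ {X} → Pred (Subgraph X) 0ℓ
Connected C = ∀ {u v} → u ∈ˢ vertices C → v ∈ˢ vertices C → Star (Edge C) u v

IsComponent : ∀ {X} → Pred (Subgraph X) (suc 0ℓ)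
IsComponent C = Connected C × (∀ D → Connected D → C ⊑ D → D ⊑ C)

Com : ∀ X Y → Pred (Hom X Y) 0ℓ
Com X Y φ = image φ (whole X) ≋ whole Y

fibre : ∀ {X Y} → Hom X Y → V Y → Subset (order X)
fibre φ y = preimageⱽ φ Subset.⁅ y ⁆

IsNonemptyFibre : ∀ {X Y} → Hom X Y → Pred (Pred (V X) 0ℓ) 0ℓ
IsNonemptyFibre φ S = ∃[ y ] Nonempty (fibre φ y) × S ≐ (_∈ˢ fibre φ y)

IsOrbit : ∀ {X} → Subgroup (Aut X) → Pred (Pred (V X) 0ℓ) 0ℓ
IsOrbit 𝔊 S = ∃[ x ] S ≐ (λ z → ∃[ f ] Member 𝔊 f × to (hom f) x ≡ z)

Consistent : ∀ {X Y} → Subgroup (Aut X) → Pred (Hom X Y) (suc 0ℓ)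
Consistent 𝔊 φ = ∀ S → IsNonemptyFibre φ S ⇔ IsOrbit 𝔊 S

O : ∀ X Y → Pred (Hom X Y) (suc 0ℓ)
O X Y φ = ∃[ 𝔊 ] Consistent 𝔊 φ

k : ∀ {X Y} → Hom X Y → Subgraph X → V Y → ℕ
k φ C y = ∣ vertices C ∩ˢ fibre φ y ∣

-- 𝒞 φ y is the set of components of X that meet the fibre over y.
𝒞 : ∀ {X Y} → Hom X Y → V Y → Pred (Subgraph X) (suc 0ℓ)
𝒞 φ y C = IsComponent C × 0 < k φ C y

CE : ∀ X Y → Pred (Hom X Y) (suc 0ℓ)
CE X Y φ = ∀ y {C D} → C U.∈ 𝒞 φ y → D U.∈ 𝒞 φ y → k φ C y ≡ k φ D y

𝒞-setoid : ∀ {X Y} → Hom X Y → V Y → Setoid (suc 0ℓ) 0ℓ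
𝒞-setoid φ y = record
  { Carrier       = Σ (Subgraph _) (𝒞 φ y)
  ; _≈_           = _≋_ on proj₁
  ; isEquivalence = record
      { refl  = (id , id) , (id , id)
      ; sym   = λ (p , q) → q , p
      ; trans = λ ((p , p′) , (q , q′)) ((r , r′) , (s , s′)) →
                  ((λ z → r (p z)) , (λ e → r′ (p′ e))) ,
                  ((λ z → q (s z)) , (λ e → q′ (s′ e)))
      }
  }

HasCardinality : ∀ {a ℓ} → Setoid a ℓ → ℕ → Set (a ⊔ ℓ)
HasCardinality S n = Inverse (setoid (Fin n)) S

∣vertices∣-nonZero : ∀ {X} (C : Subgraph X) → NonZero ∣ vertices C ∣
∣vertices∣-nonZero C =
  ℕ.>-nonZero (≤-<-trans ℕ.z≤n (x∈p⇒∣p-x∣<∣p∣ (proj₂ (Subgraph.nonempty C))))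

{-# OPTIONS --safe #-}

-- The group 𝔊 acts transitively on each nonempty fibre and permutes the
-- components, so it permutes 𝒞(X)_y transitively.  Hence for C ∈ 𝒞(X)_y every
-- element of 𝒞(X)_y is a translate of C by some f ∈ 𝔊 and φ⁻¹(φ(V_C)) is the
-- disjoint union of these translates; counting vertices gives the quotient.
-- The number c(X)_y is obtained by choosing one vertex of the fibre in each
-- component, which is effective since reachability in a finite graph is
-- decidable (Warshall's algorithm).

module Submission where

open import Defs
open import Algebra.Bundles using (Group)
open import Data.Integer.Base using (+_)
import Data.Integer.Properties as ℤₚ
open import Data.Fin.Base using (Fin; zero; suc; fromℕ<)
open import Data.Fin.Permutation using (↔⇒≡)
open import Data.Fin.Properties using (_≟_; *↔×)
open import Data.Fin.Subset using (Subset; ∣_∣; inside; outside)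
  renaming (_∈_ to _∈ˢ_; _∩_ to _∩ˢ_)
open import Data.Fin.Subset.Properties
  using (_∈?_; x∈⁅x⁆; x∈⁅y⁆⇒x≡y; x∈p∩q⁺; x∈p∩q⁻; x∈p⇒∣p-x∣<∣p∣)
open import Data.List.Base using (List; []; _∷_; allFin; filter; deduplicate; length; lookup)
open import Data.List.Membership.Propositional using () renaming (_∈_ to _∈ˡ_)
open import Data.List.Membership.Propositional.Properties
  using (∈-allFin; ∈-filter⁺; ∈-lookup)
import Data.List.Relation.Unary.All as All
import Data.List.Relation.Unary.All.Properties as All
open import Data.List.Relation.Unary.AllPairs using ([]; _∷_)
import Data.List.Relation.Unary.Any as Any
open import Data.List.Relation.Unary.Any using (here; there)
import Data.List.Relation.Unary.Any.Properties as Any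
import Data.List.Relation.Unary.Unique.Setoid as Unique
open import Data.List.Relation.Unary.Unique.DecSetoid.Properties using (deduplicate-!)
open import Data.Nat.Base as ℕ using (ℕ; NonZero; _<_)
import Data.Nat.Properties as ℕ
open import Data.Product.Base using (_×_; ∃; ∃-syntax; _,_; proj₁; proj₂)
open import Data.Product.Function.NonDependent.Propositional using (_×-↔_)
open import Data.Rational.Base using (_/_)
open import Data.Rational.Properties using (fromℚᵘ-cong)
import Data.Rational.Unnormalised.Base as ℚᵘ
open import Data.Sum.Base using (_⊎_; inj₁; inj₂)
open import Data.Vec.Base using ([]; _∷_; here; there)
open import Data.Vec.Properties.WithK using ([]=-irrelevant)
open import Function.Base using (_∘_; id)
open import Function.Bundles
  using (Inverse; Equivalence; _⇔_; mk⇔; _↔_; mk↔ₛ′; mk⤖)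
open import Function.Construct.Composition using (_↔-∘_)
open import Function.Construct.Symmetry using (↔-sym)
open import Function.Consequences.Propositional using (strictlySurjective⇒surjective)
open import Function.Properties.Bijection using (⤖⇒↔)
open import Function.Properties.Inverse using (↔-refl)
open import Level using (0ℓ)
open import Relation.Binary.Bundles using (DecSetoid; Setoid)
open import Relation.Binary.Construct.Closure.ReflexiveTransitive as Star
  using (Star; ε; _◅_; _◅◅_)
open import Relation.Binary.Core using (Rel)
open import Relation.Binary.Definitions using (Decidable; Reflexive)
open import Relation.Binary.Structures using (IsDecEquivalence)
open import Relation.Binary.PropositionalEquality
  using (_≡_; refl; sym; trans; cong; subst)
open import Relation.Nullary.Decidable using (map′; _×-dec_; _⊎-dec_)
open import Relation.Nullary.Negation using (contradiction)
open import Relation.Unary as U using (Pred; _∈_; _⊆_; _∩_)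

open Graph using (V)
open Hom using (to)
open Automorphism using (hom; inv; inverseˡ; inverseʳ)
open Subgroup using (Member; ε-closed; ∙-closed; ⁻¹-closed)
open Subgraph using (vertices; Edge)

-- Counting elements of subsets

Element : ∀ {n} → Subset n → Set
Element S = ∃ (_∈ˢ S)

-- Proofs of membership in a `Subset` are unique, so the underlying vertex decides equality.
Element-≡ : ∀ {n} {S : Subset n} {x y : Element S} → proj₁ x ≡ proj₁ y → x ≡ y
Element-≡ {x = x , p} {y = _ , q} refl = cong (x ,_) ([]=-irrelevant p q)

enumerate : ∀ {n} (S : Subset n) → Fin ∣ S ∣ ↔ Element S
enumerate []            = mk↔ₛ′ (λ ()) (λ ()) (λ ()) (λ ())
enumerate (outside ∷ S) = mk↔ₛ′
  (λ i → suc (proj₁ (S.to i)) , there (proj₂ (S.to i)))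
  (λ { (suc x , there p) → S.from (x , p) })
  (λ { (suc x , there p) → Element-≡ (cong (suc ∘ proj₁) (S.strictlyInverseˡ (x , p))) })
  S.strictlyInverseʳ
  where module S = Inverse (enumerate S)
enumerate (inside ∷ S) = mk↔ₛ′
  (λ { zero → zero , here ; (suc i) → suc (proj₁ (S.to i)) , there (proj₂ (S.to i)) })
  (λ { (zero , here) → zero ; (suc x , there p) → suc (S.from (x , p)) })
  (λ { (zero , here)     → refl
     ; (suc x , there p) → Element-≡ (cong (suc ∘ proj₁) (S.strictlyInverseˡ (x , p))) })
  (λ { zero → refl ; (suc i) → cong suc (S.strictlyInverseʳ i) })
  where module S = Inverse (enumerate S)

∣∣-cong-↔ : ∀ {m n} {S : Subset m} {T : Subset n} → Element S ↔ Element T → ∣ S ∣ ≡ ∣ T ∣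
∣∣-cong-↔ {S = S} {T} S↔T = ↔⇒≡ (↔-sym (enumerate T) ↔-∘ (S↔T ↔-∘ enumerate S))

∣∣-*-↔ : ∀ {m n} c {S : Subset m} {T : Subset n} →
         (Fin c × Element S) ↔ Element T → ∣ T ∣ ≡ c ℕ.* ∣ S ∣
∣∣-*-↔ c {S} {T} c×S↔T = sym (↔⇒≡
  (↔-sym (enumerate T) ↔-∘ (c×S↔T ↔-∘ ((↔-refl ×-↔ enumerate S) ↔-∘ *↔×))))

0<∣∣⇔Element : ∀ {n} {S : Subset n} → 0 < ∣ S ∣ ⇔ Element S
0<∣∣⇔Element {S = S} = mk⇔
  (λ 0<∣S∣ → Inverse.to (enumerate S) (fromℕ< 0<∣S∣))
  (λ (_ , x∈S) → ℕ.≤-<-trans ℕ.z≤n (x∈p⇒∣p-x∣<∣p∣ x∈S))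

-- For unnormalised fractions equality is the cross-multiplication `c * n = m * 1`. Since `mkℚᵘ`
-- stores the denominator minus one, the denominators appear as `0` and `ℕ.pred n`.
/-unique : ∀ c m n .{{_ : NonZero n}} → m ≡ c ℕ.* n → + c / 1 ≡ + m / n
/-unique c m n@(ℕ.suc _) m≡cn = fromℚᵘ-cong {ℚᵘ.mkℚᵘ (+ c) 0} {ℚᵘ.mkℚᵘ (+ m) (ℕ.pred n)}
  (ℚᵘ.*≡* (trans (sym (ℤₚ.pos-* c n)) (trans (cong +_ (sym m≡cn)) (sym (ℤₚ.*-identityʳ (+ m))))))

-- Reachability

module _ {n} {R : Rel (Fin n) 0ℓ} (R? : Decidable R) (R-refl : Reflexive R) where

  -- Walks whose intermediate vertices lie in the given list.
  Via : List (Fin n) → Rel (Fin n) 0ℓ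
  Via []       u v = R u v
  Via (w ∷ ws) u v = Via ws u v ⊎ (Via ws u w × Via ws w v)

  Via? : ∀ ws → Decidable (Via ws)
  Via? []       u v = R? u v
  Via? (w ∷ ws) u v = Via? ws u v ⊎-dec (Via? ws u w ×-dec Via? ws w v)

  R⇒Via : ∀ ws {u v} → R u v → Via ws u v
  R⇒Via []       e = e
  R⇒Via (_ ∷ ws) e = inj₁ (R⇒Via ws e)

  Via⇒Star : ∀ ws {u v} → Via ws u v → Star R u v
  Via⇒Star []       e              = e ◅ ε
  Via⇒Star (w ∷ ws) (inj₁ p)       = Via⇒Star ws p
  Via⇒Star (w ∷ ws) (inj₂ (p , q)) = Via⇒Star ws p ◅◅ Via⇒Star ws q

  -- If `w` heads the list, any closed detour at `w` is dropped and the remaining halves form an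
  -- `inj₂`. If `w` lies deeper and both walks pass through the head, the stretch between the two
  -- visits is cut out, `w` included.
  Via-trans : ∀ {ws w} → w ∈ˡ ws → ∀ {u v} → Via ws u w → Via ws w v → Via ws u v
  Via-trans (here refl) (inj₁ p)       (inj₁ q)        = inj₂ (p , q)
  Via-trans (here refl) (inj₁ p)       (inj₂ (_ , q))  = inj₂ (p , q)
  Via-trans (here refl) (inj₂ (p , _)) (inj₁ q)        = inj₂ (p , q)
  Via-trans (here refl) (inj₂ (p , _)) (inj₂ (_ , q))  = inj₂ (p , q)
  Via-trans (there w∈) (inj₁ p)        (inj₁ q)        = inj₁ (Via-trans w∈ p q)
  Via-trans (there w∈) (inj₁ p)        (inj₂ (q , q′)) = inj₂ (Via-trans w∈ p q , q′)
  Via-trans (there w∈) (inj₂ (p , p′)) (inj₁ q)        = inj₂ (p , Via-trans w∈ p′ q)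
  Via-trans (there w∈) (inj₂ (p , _))  (inj₂ (_ , q′)) = inj₂ (p , q′)

  Star⇒Via : ∀ {u v} → Star R u v → Via (allFin n) u v
  Star⇒Via = Star.fold (Via (allFin n))
    -- Every vertex is in `allFin n`, so an edge can be prepended at any joint; the empty walk
    -- becomes a loop.
    (λ e p → Via-trans (∈-allFin _) (R⇒Via (allFin n) e) p) (R⇒Via (allFin n) R-refl)

  Star? : Decidable (Star R)
  Star? u v = map′ (Via⇒Star (allFin n)) Star⇒Via (Via? (allFin n) u v)

-- Representatives of equivalence classes

module _ {a ℓ} (S : Setoid a ℓ) where
  open Setoid S using (_≈_) renaming (sym to ≈-sym)
  open Unique S using (Unique)

  Unique⇒lookup-injective : ∀ {xs} → Unique xs → ∀ i j → lookup xs i ≈ lookup xs j → i ≡ j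
  Unique⇒lookup-injective (_ ∷ _)   zero    zero    _  = refl
  Unique⇒lookup-injective (px ∷ _)  zero    (suc j) eq =
    contradiction eq (All.lookup px (∈-lookup j))
  Unique⇒lookup-injective (px ∷ _)  (suc i) zero    eq =
    contradiction (≈-sym eq) (All.lookup px (∈-lookup i))
  Unique⇒lookup-injective (_ ∷ pxs) (suc i) (suc j) eq =
    cong suc (Unique⇒lookup-injective pxs i j eq)

-- One representative, itself in `P`, for each class that meets `P`. Here `P` need not be a union of
-- classes: a fibre usually contains only some vertices of a component.
record Transversal {n} (_≈_ : Rel (Fin n) 0ℓ) (P : Pred (Fin n) 0ℓ) : Set where
  field
    size      : ℕ
    rep       : Fin size → Fin n
    rep-∈     : ∀ i → P (rep i)
    injective : ∀ i j → rep i ≈ rep j → i ≡ j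
    index     : ∀ {x} → P x → Fin size
    rep-index : ∀ {x} (px : P x) → x ≈ rep (index px)

transversal : ∀ {n} {_≈_ : Rel (Fin n) 0ℓ} {P : Pred (Fin n) 0ℓ} →
              IsDecEquivalence _≈_ → U.Decidable P → Transversal _≈_ P
transversal {n} {_≈_} {P} isDecEq P? = record
  { size      = length reps
  ; rep       = lookup reps
  ; rep-∈     = λ i → All.lookup (All.deduplicate⁺ _≈?_ (All.all-filter P? (allFin n))) (∈-lookup i)
  ; injective = Unique⇒lookup-injective setoid (deduplicate-! S (filter P? (allFin n)))
  ; index     = λ px → Any.index (reps-∈ px)
  ; rep-index = λ px → Any.lookup-index (reps-∈ px)
  }
  where
  S : DecSetoid 0ℓ 0ℓ
  S = record { isDecEquivalence = isDecEq }
  open DecSetoid S using (setoid)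
    renaming (_≟_ to _≈?_; trans to ≈-trans; sym to ≈-sym; reflexive to ≈-reflexive)
  reps : List (Fin n)
  reps = deduplicate _≈?_ (filter P? (allFin n))
  reps-∈ : ∀ {x} → P x → Any.Any (x ≈_) reps
  -- Deduplication may discard `x` itself, but it keeps something equivalent to `x`.
  reps-∈ px = Any.deduplicate⁺ _≈?_ (λ y≈z x≈z → ≈-trans x≈z (≈-sym y≈z))
    (Any.map ≈-reflexive (∈-filter⁺ P? (∈-allFin _) px))

-- Images

module _ {X Y} (φ : Hom X Y) where

  ∈-image : ∀ {S x} → x ∈ˢ S → to φ x ∈ˢ imageⱽ φ S
  ∈-image {S} x∈S = ∈-comprehension (hit? φ S) (_ , x∈S , refl)

  image-∈ : ∀ {S y} → y ∈ˢ imageⱽ φ S → ∃[ x ] x ∈ˢ S × to φ x ≡ y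
  image-∈ {S} = comprehension-∈ (hit? φ S)

  ∈-preimage : ∀ {T x} → to φ x ∈ˢ T → x ∈ˢ preimageⱽ φ T
  ∈-preimage {T} = ∈-comprehension (λ x → to φ x ∈? T)

  preimage-∈ : ∀ {T x} → x ∈ˢ preimageⱽ φ T → to φ x ∈ˢ T
  preimage-∈ {T} = comprehension-∈ (λ x → to φ x ∈? T)

  ∈-fibre : ∀ {x y} → to φ x ≡ y → x ∈ˢ fibre φ y
  ∈-fibre refl = ∈-preimage (x∈⁅x⁆ _)

  fibre-∈ : ∀ {x y} → x ∈ˢ fibre φ y → to φ x ≡ y
  fibre-∈ x∈ = x∈⁅y⁆⇒x≡y _ (preimage-∈ x∈)

  0<k⇔meets : ∀ {C y} → 0 < k φ C y ⇔ (∃[ x ] x ∈ˢ vertices C × to φ x ≡ y)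
  0<k⇔meets {C} {y} = mk⇔
    (λ 0<k → let (x , x∈) = Equivalence.to 0<∣∣⇔Element 0<k
                 (x∈C , x∈F) = x∈p∩q⁻ (vertices C) (fibre φ y) x∈
             in x , x∈C , fibre-∈ x∈F)
    (λ (x , x∈C , φx≡y) → Equivalence.from 0<∣∣⇔Element (x , x∈p∩q⁺ (x∈C , ∈-fibre φx≡y)))

  image-Connected : ∀ {C} → Connected C → Connected (image φ C)
  image-Connected conn u∈ v∈ with image-∈ u∈ | image-∈ v∈
  ... | x , x∈ , refl | z , z∈ , refl =
    Star.gmap (to φ) (λ e → _ , _ , e , refl , refl) (conn x∈ z∈)

-- Components

module _ {X : Graph} where
  open Graph X using (_~_; _~?_; ~-refl; ~-sym)

  abstract
    reachable? : Decidable (Star _~_)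
    reachable? = Star? _~?_ ~-refl

  ⊑-trans : {C D E : Subgraph X} → C ⊑ D → D ⊑ E → C ⊑ E
  ⊑-trans (p , p′) (q , q′) = (λ x∈ → q (p x∈)) , (λ e → q′ (p′ e))

  ≋-sym : {C D : Subgraph X} → C ≋ D → D ≋ C
  ≋-sym (p , q) = q , p

  ≋-trans : {C D E : Subgraph X} → C ≋ D → D ≋ E → C ≋ E
  ≋-trans {C} {D} {E} (p , p′) (q , q′) = ⊑-trans {C} {D} {E} p q , ⊑-trans {E} {D} {C} q′ p′

  IsComponent-resp-≋ : {C D : Subgraph X} → C ≋ D → IsComponent C → IsComponent D
  IsComponent-resp-≋ {C} {D} (C⊑D , D⊑C) (conn , maximal) =
    (λ u∈ v∈ → Star.map (proj₂ C⊑D) (conn (proj₁ D⊑C u∈) (proj₁ D⊑C v∈))) ,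
    (λ E connE D⊑E → ⊑-trans {E} {C} {D} (maximal E connE (⊑-trans {C} {D} {E} C⊑D D⊑E)) C⊑D)

  -- An edge needs only its first endpoint reachable from `x`: the edge itself extends the walk to
  -- the second one.
  component : V X → Subgraph X
  component x = record
    { vertices = comprehension (reachable? x)
    ; nonempty = x , ∈-comprehension (reachable? x) ε
    ; Edge     = λ u v → Star _~_ x u × u ~ v
    ; Edge?    = λ u v → reachable? x u ×-dec (u ~? v)
    ; loops    = λ u∈ → comprehension-∈ (reachable? x) u∈ , ~-refl
    ; Edge-sym = λ (p , e) → p ◅◅ (e ◅ ε) , ~-sym e
    ; endpoint = λ (p , _) → ∈-comprehension (reachable? x) p
    ; Edge⇒~   = proj₂
    }

  ∈-component : ∀ {x u} → Star _~_ x u → u ∈ˢ vertices (component x)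
  ∈-component {x} = ∈-comprehension (reachable? x)

  component-∈ : ∀ {x u} → u ∈ˢ vertices (component x) → Star _~_ x u
  component-∈ {x} = comprehension-∈ (reachable? x)

  -- A walk inside `C` is a walk in `X`. This makes `component x` the largest connected subgraph
  -- containing `x`.
  connected⊑component : ∀ {C : Subgraph X} {x} → Connected C → x ∈ˢ vertices C → C ⊑ component x
  connected⊑component {C} {x} conn x∈ = (λ u∈ → ∈-component (walk u∈)) ,
    (λ e → walk (Subgraph.endpoint C e) , Subgraph.Edge⇒~ C e)
    where
    walk : ∀ {u} → u ∈ˢ vertices C → Star _~_ x u
    walk u∈ = Star.map (Subgraph.Edge⇒~ C) (conn x∈ u∈)

  component-isComponent : ∀ x → IsComponent (component x)
  component-isComponent x =
    (λ u∈ v∈ → let p = component-∈ u∈ in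
      within p (Star.reverse ~-sym p ◅◅ component-∈ v∈)) ,
    (λ D conn x⊑D → connected⊑component {D} conn (proj₁ x⊑D (∈-component ε)))
    where
    -- The walk from `x` grows along with `q`, certifying that each edge of `q` starts at a vertex
    -- reachable from `x`.
    within : ∀ {u v} → Star _~_ x u → Star _~_ u v → Star (Edge (component x)) u v
    within p ε       = ε
    within p (e ◅ q) = (p , e) ◅ within (p ◅◅ (e ◅ ε)) q

  component-unique : ∀ {C : Subgraph X} {x} → IsComponent C → x ∈ˢ vertices C → C ≋ component x
  component-unique {C} {x} (conn , maximal) x∈ =
    C⊑x , maximal (component x) (proj₁ (component-isComponent x)) C⊑x
    where
    C⊑x : C ⊑ component x
    C⊑x = connected⊑component {C} conn x∈

  components-meet⇒≋ : ∀ {C D : Subgraph X} {x} → IsComponent C → IsComponent D →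
                      x ∈ˢ vertices C → x ∈ˢ vertices D → C ≋ D
  components-meet⇒≋ {C} {D} {x} compC compD x∈C x∈D =
    ≋-trans {C} {component x} {D}
      (component-unique {C} compC x∈C) (≋-sym {D} {component x} (component-unique {D} compD x∈D))

  component-cong : ∀ {x z} → Star _~_ x z → component x ≋ component z
  component-cong {x} {z} p =
    component-unique {component x} (component-isComponent x) (∈-component p)

  reachable-isDecEquivalence : IsDecEquivalence (Star _~_)
  reachable-isDecEquivalence = record
    { isEquivalence = record { refl = ε ; sym = Star.reverse ~-sym ; trans = _◅◅_ }
    ; _≟_           = reachable?
    }

  -- Apply `inv f` to both sides and cancel. Used for `f ⁻¹`, the same statement moves `f` back
  -- across the inclusion.
  image-adjoint : ∀ (f : Automorphism X) {C D : Subgraph X} →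
                  image (hom f) C ⊑ D → C ⊑ image (inv f) D
  image-adjoint f {C} {D} (p , p′) =
    (λ {x} x∈ → subst (_∈ˢ vertices (image (inv f) D)) (inverseʳ f x)
                  (∈-image (inv f) (p (∈-image (hom f) x∈)))) ,
    (λ e → _ , _ , p′ (_ , _ , e , refl , refl) , inverseʳ f _ , inverseʳ f _)

  -- Maximality is transported: a connected `D` above the image of `C` pulls back along `inv f` to a
  -- connected subgraph above `C`, hence one contained in `C`.
  image-isComponent : ∀ (f : Automorphism X) {C : Subgraph X} →
                      IsComponent C → IsComponent (image (hom f) C)
  image-isComponent f {C} (conn , maximal) =
    image-Connected (hom f) {C} conn ,
    (λ D connD fC⊑D → image-adjoint (f ⁻¹) {D} {C}
      (maximal (image (inv f) D) (image-Connected (inv f) {D} connD)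
        (image-adjoint f {C} {D} fC⊑D)))
    where open Group (Aut X) using (_⁻¹)

  image-injective : ∀ (f : Automorphism X) {x z} → to (hom f) x ≡ to (hom f) z → x ≡ z
  image-injective f eq = trans (sym (inverseʳ f _)) (trans (cong (to (inv f)) eq) (inverseʳ f _))

-- Finiteness of the set of components meeting a fibre

𝒞-finite : ∀ {X Y} (φ : Hom X Y) y → ∃ (HasCardinality (𝒞-setoid φ y))
𝒞-finite {X} φ y = size , record
  { to        = λ i → component (rep i) , component-isComponent (rep i) ,
                  Equivalence.from (0<k⇔meets φ {component (rep i)}) (rep i , ∈-component ε , rep-∈ i)
  ; from      = classify
  ; to-cong   = λ { {i} refl → (id , id) , (id , id) }
  ; from-cong = λ {C} {D} C≋D → classify-unique C
                  (≋-trans {X} {proj₁ C} {proj₁ D} {component (rep (classify D))} C≋D (classified D))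
  ; inverse   = (λ { {C} refl → ≋-sym {X} {proj₁ C} {component (rep (classify C))} (classified C) })
              , (λ {i} {C} C≋i → classify-unique C C≋i)
  }
  where
  open Graph X using (_~_; ~-sym)
  open Transversal (transversal (reachable-isDecEquivalence {X}) (λ x → to φ x ≟ y))
  meets : ∀ C → C ∈ 𝒞 φ y → ∃[ x ] x ∈ˢ vertices C × to φ x ≡ y
  meets C (_ , 0<k) = Equivalence.to (0<k⇔meets φ {C}) 0<k
  classify : ∃ (𝒞 φ y) → Fin size
  classify (C , C∈) = index (proj₂ (proj₂ (meets C C∈)))
  classified : ((C , C∈) : ∃ (𝒞 φ y)) → C ≋ component (rep (classify (C , C∈)))
  classified (C , C∈@(compC , _)) =
    let (x , x∈C , φx≡y) = meets C C∈ in
    ≋-trans {X} {C} {component x} {component (rep (index φx≡y))}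
      (component-unique {C = C} compC x∈C) (component-cong (rep-index φx≡y))
  -- Two representatives in one component are mutually reachable, so they have the same index. Hence
  -- the choice of fibre vertex made by `meets` does not matter.
  classify-unique : ((C , C∈) : ∃ (𝒞 φ y)) → ∀ {i} → C ≋ component (rep i) → classify (C , C∈) ≡ i
  classify-unique C∈@(C , _) {i} C≋i =
    injective _ i (Star.reverse ~-sym (component-∈ (proj₁ (proj₁ (≋-trans {X}
      {component (rep (classify C∈))} {C} {component (rep i)}
      (≋-sym {X} {C} {component (rep (classify C∈))} (classified C∈)) C≋i)) (∈-component ε))))

-- The action of the group on fibres and components

module _ {X Y} (φ : Hom X Y) (𝔊 : Subgroup (Aut X)) (consistent : Consistent 𝔊 φ) where
  open Group (Aut X) using (_∙_; _⁻¹) renaming (ε to ι)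

  abstract
    -- The common fibre is the orbit of some base point `w`. If `g` carries `w` to `x` and `h`
    -- carries `w` to `z`, then `h ∙ g ⁻¹` carries `x` to `z`.
    orbits-transitive : ∀ {x z} → to φ x ≡ to φ z → ∃[ f ] Member 𝔊 f × to (hom f) x ≡ z
    orbits-transitive {x} {z} φx≡φz =
      let (_ , fibre⊆orbit , _) = Equivalence.to (consistent (_∈ˢ fibre φ (to φ z)))
                                    (to φ z , (z , ∈-fibre φ refl) , id , id)
          (g , g∈ , gw≡x) = fibre⊆orbit (∈-fibre φ φx≡φz)
          (h , h∈ , hw≡z) = fibre⊆orbit (∈-fibre φ refl)
      in h ∙ g ⁻¹ , ∙-closed 𝔊 h∈ (⁻¹-closed 𝔊 g∈) ,
         trans (cong (to (hom h)) (trans (cong (to (inv g)) (sym gw≡x)) (inverseʳ g _))) hw≡z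

    φ-invariant : ∀ {f} → Member 𝔊 f → ∀ x → to φ (to (hom f) x) ≡ to φ x
    φ-invariant {f} f∈ x =
      -- The set supplied to consistency is the orbit of `x`. It is a fibre containing the image of
      -- `x` under `f` and, through the identity, `x` itself.
      let (_ , _ , orbit⊆fibre , _) = Equivalence.from (consistent _) (x , id , id)
      in trans (fibre-∈ φ (orbit⊆fibre (f , f∈ , refl)))
               (sym (fibre-∈ φ (orbit⊆fibre (ι , ε-closed 𝔊 , refl))))

    -- Some `f` in the group carries a fibre vertex of `C` to one of `D`; then the image of `C` and
    -- `D` are components sharing a vertex.
    𝒞-translate : ∀ {y C D} → C ∈ 𝒞 φ y → D ∈ 𝒞 φ y → ∃[ f ] Member 𝔊 f × D ≋ image (hom f) C
    𝒞-translate {y} {C} {D} (compC , 0<kC) (compD , 0<kD)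
      with Equivalence.to (0<k⇔meets φ {C}) 0<kC | Equivalence.to (0<k⇔meets φ {D}) 0<kD
    ... | x , x∈C , φx≡y | z , z∈D , φz≡y with orbits-transitive (trans φx≡y (sym φz≡y))
    ... | f , f∈ , refl = f , f∈ ,
      components-meet⇒≋ {C = D} {image (hom f) C} compD (image-isComponent f {C} compC)
        z∈D (∈-image (hom f) x∈C)

    translate-𝒞 : ∀ {y C D f} → C ∈ 𝒞 φ y → Member 𝔊 f → D ≋ image (hom f) C → D ∈ 𝒞 φ y
    translate-𝒞 {C = C} {D} {f} (compC , 0<kC) f∈ D≋fC =
      let (x , x∈C , φx≡y) = Equivalence.to (0<k⇔meets φ {C}) 0<kC in
      IsComponent-resp-≋ {C = image (hom f) C} {D} (≋-sym {C = D} {image (hom f) C} D≋fC)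
        (image-isComponent f {C} compC) ,
      Equivalence.from (0<k⇔meets φ {D})
        (_ , proj₁ (proj₂ D≋fC) (∈-image (hom f) x∈C) , trans (φ-invariant f∈ x) φx≡y)

  -- An `f` carrying `C` to `D` preserves `φ`, so it restricts to a bijection between their parts of
  -- the fibre.
  component-equitable : CE X Y φ
  component-equitable y {C} {D} C∈ D∈ with 𝒞-translate {y} {C} {D} C∈ D∈
  ... | f , f∈ , (D⊑fC , fC⊑D) = ∣∣-cong-↔ (mk↔ₛ′ (λ (x , p) → to (hom f) x , push p)
    (λ (z , q) → to (inv f) z , pull q)
    (λ _ → Element-≡ (inverseˡ f _)) (λ _ → Element-≡ (inverseʳ f _)))
    where
    push : ∀ {x} → x ∈ˢ vertices C ∩ˢ fibre φ y → to (hom f) x ∈ˢ vertices D ∩ˢ fibre φ y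
    push {x} p = let (x∈C , x∈F) = x∈p∩q⁻ (vertices C) (fibre φ y) p in
      x∈p∩q⁺ (proj₁ fC⊑D (∈-image (hom f) x∈C) ,
              ∈-fibre φ (trans (φ-invariant f∈ x) (fibre-∈ φ x∈F)))
    pull : ∀ {z} → z ∈ˢ vertices D ∩ˢ fibre φ y → to (inv f) z ∈ˢ vertices C ∩ˢ fibre φ y
    pull {z} q with x∈p∩q⁻ (vertices D) (fibre φ y) q
    ... | z∈D , z∈F with image-∈ (hom f) (proj₁ D⊑fC z∈D)
    ... | x , x∈C , refl = subst (_∈ˢ vertices C ∩ˢ fibre φ y) (sym (inverseʳ f x))
      (x∈p∩q⁺ (x∈C , ∈-fibre φ (trans (sym (φ-invariant f∈ x)) (fibre-∈ φ z∈F))))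

  -- The bijection sends (i , x) to the image of x under a member of 𝔊 carrying
  -- C to the i-th component.
  saturation-size : ∀ {y c} → HasCardinality (𝒞-setoid φ y) c → ∀ {C} → C ∈ 𝒞 φ y →
                    ∣ preimageⱽ φ (imageⱽ φ (vertices C)) ∣ ≡ c ℕ.* ∣ vertices C ∣
  saturation-size {y} {c} count {C} C∈ = ∣∣-*-↔ c (⤖⇒↔ (mk⤖ {to = move}
    ((λ {p} {q} → move-injective p q) , strictlySurjective⇒surjective move-surjective)))
    where
    open Inverse count using (inverse) renaming (to to nth; from to position)
    nth-translate : ∀ i → ∃[ f ] Member 𝔊 f × proj₁ (nth i) ≋ image (hom f) C
    nth-translate i = 𝒞-translate {y} {C} {proj₁ (nth i)} C∈ (proj₂ (nth i))
    mover : Fin c → Automorphism X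
    mover i = proj₁ (nth-translate i)
    mover-∈ : ∀ i {x} → x ∈ˢ vertices C → to (hom (mover i)) x ∈ˢ vertices (proj₁ (nth i))
    mover-∈ i x∈C = proj₁ (proj₂ (proj₂ (proj₂ (nth-translate i)))) (∈-image (hom (mover i)) x∈C)
    -- Components sharing a vertex coincide, so `position` of the `i`-th one equals both `i` and
    -- `j`.
    nth-injective : ∀ i j {x} → x ∈ˢ vertices (proj₁ (nth i)) → x ∈ˢ vertices (proj₁ (nth j)) → i ≡ j
    nth-injective i j x∈i x∈j = trans (sym (proj₂ inverse {i} {nth i} ((id , id) , (id , id))))
      (proj₂ inverse {j} {nth i} (components-meet⇒≋ {C = proj₁ (nth i)} {proj₁ (nth j)}
        (proj₁ (proj₂ (nth i))) (proj₁ (proj₂ (nth j))) x∈i x∈j))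
    move : Fin c × Element (vertices C) → Element (preimageⱽ φ (imageⱽ φ (vertices C)))
    move (i , x , x∈C) = to (hom (mover i)) x , ∈-preimage φ
      (subst (_∈ˢ imageⱽ φ (vertices C)) (sym (φ-invariant (proj₁ (proj₂ (nth-translate i))) x))
        (∈-image φ x∈C))
    -- Once the indices are identified, both vertices are moved by the same automorphism, which is
    -- injective.
    pair-injective : ∀ {i j} {p q : Element (vertices C)} → i ≡ j →
                     to (hom (mover i)) (proj₁ p) ≡ to (hom (mover j)) (proj₁ q) → (i , p) ≡ (j , q)
    pair-injective {i} refl eq = cong (i ,_) (Element-≡ (image-injective (mover i) eq))
    move-injective : ∀ p q → move p ≡ move q → p ≡ q
    move-injective (i , x , x∈C) (j , z , z∈C) eq = pair-injective
      (nth-injective i j (mover-∈ i x∈C)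
        (subst (_∈ˢ vertices (proj₁ (nth j))) (sym (cong proj₁ eq)) (mover-∈ j z∈C)))
      (cong proj₁ eq)
    move-surjective : ∀ t → ∃[ p ] move p ≡ t
    -- Some `f` carries a vertex of `C` to `z`, so `z` lies in a translate listed at some `i`. The
    -- chosen `mover i` may differ from `f`, but it carries `C` onto the same component, so a
    -- possibly different vertex `w` of `C` reaches `z`.
    move-surjective (z , z∈) with image-∈ φ (preimage-∈ φ z∈)
    ... | x , x∈C , φx≡φz with orbits-transitive φx≡φz
    ... | f , f∈ , refl =
      let D = image (hom f) C
          D∈ = translate-𝒞 {y} {C} {D} C∈ f∈ ((id , id) , (id , id))
          i = position (D , D∈)
          (_ , D⊑nth) = proj₁ inverse {D , D∈} refl
          (w , w∈C , eq) = image-∈ (hom (mover i))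
            (proj₁ (proj₁ (proj₂ (proj₂ (nth-translate i)))) (proj₁ D⊑nth (∈-image (hom f) x∈C)))
      in (i , w , w∈C) , Element-≡ eq

proposition6p9 : (X Y : Graph) (φ : Hom X Y)
    (𝔊 : Subgroup (Aut X)) → Consistent 𝔊 φ →
    (y : Graph.V Y) →
    ( (∀ C → C ∈ 𝒞 φ y →
    ∀ D → D ∈ 𝒞 φ y ⇔ (∃[ f ] (Subgroup.Member 𝔊 f × D ≋ image (Automorphism.hom f) C)))
    × (∀ C D → C ∈ 𝒞 φ y → D ∈ 𝒞 φ y →
    ∃[ f ] image (Automorphism.hom {X} f) C ≋ D) )
    × O X Y ⊆ CE X Y
    × ( φ ∈ O X Y ∩ Com X Y →
    ∃[ c ] HasCardinality (𝒞-setoid φ y) c ×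
    (∀ C → C ∈ 𝒞 φ y →
    + c / 1 ≡
    (+ ∣ preimageⱽ φ (imageⱽ φ (Subgraph.vertices C)) ∣ / ∣ Subgraph.vertices C ∣)
    {{∣vertices∣-nonZero C}}) )
proposition6p9 X Y φ 𝔊 consistent y =
  ( (λ C C∈ D → mk⇔ (𝒞-translate φ 𝔊 consistent {y} {C} {D} C∈)
      (λ (f , f∈ , D≋fC) → translate-𝒞 φ 𝔊 consistent {y} {C} {D} {f} C∈ f∈ D≋fC))
  , (λ C D C∈ D∈ → let (f , _ , D≋fC) = 𝒞-translate φ 𝔊 consistent {y} {C} {D} C∈ D∈ in
      f , ≋-sym {C = D} {image (hom f) C} D≋fC) )
  -- The inclusion ranges over all orbit homomorphisms, so each `ψ` comes with its own subgroup `ℌ`.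
  , (λ { {ψ} (ℌ , ℌ-consistent) → component-equitable ψ ℌ ℌ-consistent })
  , (λ _ → let (c , count) = 𝒞-finite φ y in
      c , count , λ C C∈ →
        /-unique c ∣ preimageⱽ φ (imageⱽ φ (vertices C)) ∣ ∣ vertices C ∣ {{∣vertices∣-nonZero C}}
          (saturation-size φ 𝔊 consistent {y} count {C} C∈))
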